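{- If $G$ is a connected graph of order at least $3$ such that $$|N_G(u)\cap N_G(v)\cap N_G(w)|>|N_G(u)\setminus (N_G[v]\cup N_G[w])|$$ for every induced path $vuw$ of order $3$ in $G$ (that is, for all distinct vertices $u,v,w$ with $u$ adjacent to both $v$ and $w$, and $v$ not adjacent to $w$), then $G$ is fully cycle extendable.
   Context: All graphs are finite, simple, and undirected. $n(G)$ is the order of $G$; $N_G(u)$ is the (open) neighborhood of $u$ in $G$ and $N_G[u]=N_G(u)\cup\{u\}$ its closed neighborhood. A cycle $C$ in $G$ is extendable if $G$ contains a cycle $C'$ of order $n(C)+1$ with $V(C)\subseteq V(C')$. $G$ is fully cycle extendable if every vertex of $G$ lies on a triangle and every cycle in $G$ of order less than $n(G)$ is extendable. -}

module Defs where

open import Level using (0ℓ)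
open import Data.Nat.Base using (ℕ; suc; _≤_; _<_)
open import Data.Fin.Base using (Fin)
open import Data.Fin.Subset using (Subset; ⁅_⁆; _∪_)
open import Data.List.Base using (List; _∷_; _∷ʳ_; length)
open import Data.List.Relation.Binary.Subset.Propositional using (_⊆_)
open import Data.List.Relation.Unary.Linked using (Linked)
open import Data.List.Relation.Unary.Unique.Propositional using (Unique)
open import Data.Product.Base using (∃-syntax; ∃₂; _×_)
open import Data.Vec.Base using (tabulate)
open import Relation.Binary.Construct.Closure.ReflexiveTransitive using (Star)
open import Relation.Binary.Core using (Rel)
open import Relation.Binary.Definitions using (Decidable; Irreflexive; Symmetric)
open import Relation.Binary.PropositionalEquality.Core using (_≡_; _≢_)
open import Relation.Nullary using (¬_; does)

-- A finite simple undirected graph of order n, with vertex set Fin n.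
record Graph (n : ℕ) : Set₁ where
  infix 4 _~_ _~?_
  field
    _~_    : Rel (Fin n) 0ℓ
    _~?_   : Decidable _~_
    sym    : Symmetric _~_
    irrefl : Irreflexive _≡_ _~_

module _ {n : ℕ} (G : Graph n) where
  open Graph G

  N : Fin n → Subset n
  N u = tabulate (λ v → does (u ~? v))

  N[_] : Fin n → Subset n
  N[ u ] = N u ∪ ⁅ u ⁆

  Connected : Set
  Connected = ∀ u v → Star _~_ u v

  -- u is the middle vertex; u differs from v and w because _~_ is irreflexive.
  InducedPath₃ : (v u w : Fin n) → Set
  InducedPath₃ v u w = v ≢ w × u ~ v × u ~ w × ¬ v ~ w

  -- A cycle is given by listing its vertices once around, from some vertex and
  -- in some direction, so each cycle subgraph has several representations.
  record Cycle : Set where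
    field
      start  : Fin n
      rest   : List (Fin n)
      unique : Unique (start ∷ rest)
      closed : Linked _~_ (start ∷ rest ∷ʳ start)
      long   : 3 ≤ length (start ∷ rest)

    vertices : List (Fin n)
    vertices = start ∷ rest

    order : ℕ
    order = length vertices

  open Cycle

  Extendable : Cycle → Set
  Extendable C = ∃[ C′ ] (order C′ ≡ suc (order C) × vertices C ⊆ vertices C′)

  OnTriangle : Fin n → Set
  OnTriangle u = ∃₂ λ v w → u ~ v × v ~ w × w ~ u

  FullyCycleExtendable : Set
  FullyCycleExtendable =
    (∀ u → OnTriangle u) × (∀ C → order C < n → Extendable C)

{-# OPTIONS --safe #-}

-- Let x be a vertex off a cycle C and adjacent to it, let W be the set of
-- neighbours of x on C, and write w⁺ for the successor of w on C.  If C is not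
-- extendable, the vertices w⁺ with w ∈ W are pairwise nonadjacent and nonadjacent
-- to x, and every common neighbour of w, w⁺ lies on C.  The hypothesis for the
-- induced path x w w⁺ then says that |{ q ∈ W : w ~ q⁺ }| < |{ q ∈ W : q ~ w⁺ }|.
-- Summed over w ∈ W, both sides count the same pairs, a contradiction.
module Submission where

open import Defs
open import Data.Nat.Base using (ℕ; _≤_; _>_)
open import Data.Fin.Base using (Fin)
open import Data.Fin.Subset using (∣_∣; _∩_; _∪_; _─_)

open import Data.Bool.Base using (true; false)
open import Data.Empty using (⊥-elim)
open import Data.Fin.Properties using (_≟_; any?)
open import Data.Fin.Subset using (Subset; ⁅_⁆; ⋃; ⊤)
  renaming (_∈_ to _∈ₛ_; _∉_ to _∉ₛ_)
open import Data.Fin.Subset.Properties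
  using (∣⊥∣≡0; ∣⊤∣≡n; ∣⁅x⁆∣≡1; x∈⁅x⁆; x∈⁅y⁆⇒x≡y; p⊆q⇒∣p∣≤∣q∣; p⊂q⇒∣p∣<∣q∣; p⊆p∪q;
         x∈p∩q⁻; x∈p∪q⁺; x∈p∪q⁻; x∈p∧x∉q⇒x∈p─q; x∈p∧x≢y⇒x∈p-y; x∈p⇒∣p-x∣<∣p∣)
open import Data.List.Base using (List; []; _∷_; _∷ʳ_; _++_; length; map; filter)
import Data.List.Membership.DecPropositional as DecMembership
open import Data.List.Membership.Propositional using (_∈_; _∉_; find; lose)
open import Data.List.Membership.Propositional.Properties
  using (∈-filter⁺; ∈-filter⁻; ∈-map⁺; ∈-map⁻)
open import Data.List.Properties using (length-map)
open import Data.List.Relation.Binary.Permutation.Propositional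
  using (_↭_; prep; ↭-refl; ↭-sym; ↭-trans; ↭⇒↭ₛ; module PermutationReasoning)
open import Data.List.Relation.Binary.Permutation.Propositional.Properties
  using (∈-resp-↭; ↭-length; ++⁺ʳ; ++-comm; ∷↭∷ʳ)
import Data.List.Relation.Binary.Permutation.Setoid.Properties as Permutation
open import Data.List.Relation.Unary.All using ([]; _∷_)
import Data.List.Relation.Unary.All as All
open import Data.List.Relation.Unary.AllPairs using ([]; _∷_)
import Data.List.Relation.Unary.AllPairs.Properties as AllPairs
import Data.List.Relation.Unary.Any as Any
open import Data.List.Relation.Unary.Any using (here; there)
open import Data.List.Relation.Unary.Linked using (Linked; [-]; _∷_)
open import Data.List.Relation.Unary.Unique.Propositional using (Unique)
open import Data.Nat.Base using (_+_; _<_; suc; z≤n; s≤s)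
open import Data.Nat.ListAction using (sum)
open import Data.Nat.Properties
  using (≤-reflexive; ≤-trans; <⇒≤; <⇒≱; <-irrefl; m≤n⇒m≤1+n; n≤1+n; +-mono-≤; +-mono-<-≤;
         +-monoʳ-≤; +-suc; +-comm; +-commutativeSemigroup; module ≤-Reasoning)
open import Data.Product.Base using (Σ; ∃; ∃₂; ∃-syntax; _×_; _,_; proj₁; proj₂)
open import Data.Sum.Base using (_⊎_; inj₁; inj₂)
open import Data.Vec.Base using ([]; _∷_)
open import Data.Vec.Properties using (lookup∘tabulate; lookup⇒[]=; []=⇒lookup)
open import Function.Base using (_∘_)
open import Relation.Binary.Construct.Closure.ReflexiveTransitive using (Star; ε; _◅_)
open import Relation.Binary.PropositionalEquality
  using (_≡_; _≢_; refl; sym; trans; cong; subst; setoid)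
open import Relation.Nullary using (¬_; Dec; yes; no; does; contradiction)
open import Relation.Nullary.Decidable using (dec-true; _×-dec_; decidable-stable)
open import Relation.Unary using (Decidable)
open import Algebra.Properties.CommutativeSemigroup +-commutativeSemigroup using (x∙yz≈y∙xz)

private
  variable
    n : ℕ

  open module FinMembership {n} = DecMembership (_≟_ {n}) using (_∈?_; _∉?_)

-- Sizes of subsets compared with lengths of lists.

length≤∣-∣ : {l : List (Fin n)} {p : Subset n} → Unique l → (∀ {x} → x ∈ l → x ∈ₛ p) →
  length l ≤ ∣ p ∣
length≤∣-∣ [] _ = z≤n
length≤∣-∣ {l = x ∷ l} (x∉l ∷ l!) l⊆p = ≤-trans
  (s≤s (length≤∣-∣ l! λ y∈l → x∈p∧x≢y⇒x∈p-y (l⊆p (there y∈l)) (All.lookup x∉l y∈l ∘ sym)))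
  (x∈p⇒∣p-x∣<∣p∣ (l⊆p (here refl)))

∣p∪q∣≤∣p∣+∣q∣ : (p q : Subset n) → ∣ p ∪ q ∣ ≤ ∣ p ∣ + ∣ q ∣
∣p∪q∣≤∣p∣+∣q∣ []          []          = z≤n
∣p∪q∣≤∣p∣+∣q∣ (true  ∷ p) (true  ∷ q) =
  s≤s (≤-trans (∣p∪q∣≤∣p∣+∣q∣ p q) (+-monoʳ-≤ ∣ p ∣ (n≤1+n ∣ q ∣)))
∣p∪q∣≤∣p∣+∣q∣ (true  ∷ p) (false ∷ q) = s≤s (∣p∪q∣≤∣p∣+∣q∣ p q)
∣p∪q∣≤∣p∣+∣q∣ (false ∷ p) (true  ∷ q) =
  ≤-trans (s≤s (∣p∪q∣≤∣p∣+∣q∣ p q)) (≤-reflexive (sym (+-suc ∣ p ∣ ∣ q ∣)))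
∣p∪q∣≤∣p∣+∣q∣ (false ∷ p) (false ∷ q) = ∣p∪q∣≤∣p∣+∣q∣ p q

∣p∪⁅x⁆∣≤1+∣p∣ : (p : Subset n) (x : Fin n) → ∣ p ∪ ⁅ x ⁆ ∣ ≤ suc ∣ p ∣
∣p∪⁅x⁆∣≤1+∣p∣ p x = begin
  ∣ p ∪ ⁅ x ⁆ ∣      ≤⟨ ∣p∪q∣≤∣p∣+∣q∣ p ⁅ x ⁆ ⟩
  ∣ p ∣ + ∣ ⁅ x ⁆ ∣  ≡⟨ cong (∣ p ∣ +_) (∣⁅x⁆∣≡1 x) ⟩
  ∣ p ∣ + 1          ≡⟨ +-comm ∣ p ∣ 1 ⟩
  suc ∣ p ∣          ∎
  where open ≤-Reasoning

x∉p⇒∣p∣<∣p∪⁅x⁆∣ : {p : Subset n} {x : Fin n} → x ∉ₛ p → ∣ p ∣ < ∣ p ∪ ⁅ x ⁆ ∣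
x∉p⇒∣p∣<∣p∪⁅x⁆∣ {p = p} {x} x∉p =
  p⊂q⇒∣p∣<∣q∣ (p⊆p∪q ⁅ x ⁆ , x , x∈p∪q⁺ (inj₂ (x∈⁅x⁆ x)) , x∉p)

-- Here `l` may repeat entries: `p` lies in the union of the singletons of `l`, and the size of a
-- union is subadditive.
∣-∣≤length : (l : List (Fin n)) {p : Subset n} → (∀ {x} → x ∈ₛ p → x ∈ l) → ∣ p ∣ ≤ length l
∣-∣≤length l p⊆l = ≤-trans (p⊆q⇒∣p∣≤∣q∣ (listed l ∘ p⊆l)) (∣⋃∣≤length l)
  where
  listed : (l : List (Fin n)) {x : Fin n} → x ∈ l → x ∈ₛ ⋃ (map ⁅_⁆ l)
  listed (y ∷ l) (here refl) = x∈p∪q⁺ (inj₁ (x∈⁅x⁆ y))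
  listed (y ∷ l) (there x∈l) = x∈p∪q⁺ (inj₂ (listed l x∈l))

  ∣⋃∣≤length : (l : List (Fin n)) → ∣ ⋃ (map ⁅_⁆ l) ∣ ≤ length l
  ∣⋃∣≤length {n} []  = ≤-reflexive (∣⊥∣≡0 n)
  ∣⋃∣≤length (y ∷ l) = ≤-trans (∣p∪q∣≤∣p∣+∣q∣ ⁅ y ⁆ (⋃ (map ⁅_⁆ l)))
    (+-mono-≤ (≤-reflexive (∣⁅x⁆∣≡1 y)) (∣⋃∣≤length l))

∃-unlisted : (l : List (Fin n)) → length l < n → ∃ (_∉ l)
∃-unlisted {n} l ∣l∣<n with any? (λ x → x ∉? l)
... | yes unlisted = unlisted
... | no  ∄        = contradiction
  (≤-trans (≤-reflexive (sym (∣⊤∣≡n n)))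
    (∣-∣≤length l {⊤} λ {x} _ → decidable-stable (x ∈? l) λ x∉l → ∄ (x , x∉l)))
  (<⇒≱ ∣l∣<n)

-- Double counting.

module _ {a b r} {A : Set a} {B : Set b} {R : A → B → Set r} (R? : ∀ x y → Dec (R x y)) where

  sum-length-filter-∷ : ∀ x xs ys →
    sum (map (λ y → length (filter (λ x → R? x y) (x ∷ xs))) ys) ≡
    length (filter (R? x) ys) + sum (map (λ y → length (filter (λ x → R? x y) xs)) ys)
  sum-length-filter-∷ x xs []       = refl
  sum-length-filter-∷ x xs (y ∷ ys) with does (R? x y)
  ... | true  = cong suc (trans
    (cong (length (filter (λ x → R? x y) xs) +_) (sum-length-filter-∷ x xs ys))
    (x∙yz≈y∙xz (length (filter (λ x → R? x y) xs)) (length (filter (R? x) ys)) _))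
  ... | false = trans
    (cong (length (filter (λ x → R? x y) xs) +_) (sum-length-filter-∷ x xs ys))
    (x∙yz≈y∙xz (length (filter (λ x → R? x y) xs)) (length (filter (R? x) ys)) _)

  -- Both sums count the pairs related by `R`, once by rows and once by columns; the induction peels
  -- off one row at a time.
  sum-length-filter-comm : ∀ xs ys →
    sum (map (λ x → length (filter (R? x) ys)) xs) ≡
    sum (map (λ y → length (filter (λ x → R? x y) xs)) ys)
  sum-length-filter-comm []       []       = refl
  sum-length-filter-comm []       (y ∷ ys) = sum-length-filter-comm [] ys
  sum-length-filter-comm (x ∷ xs) ys       = trans
    (cong (length (filter (R? x) ys) +_) (sum-length-filter-comm xs ys))
    (sym (sum-length-filter-∷ x xs ys))

module _ {a} {A : Set a} {f g : A → ℕ} where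

  sum-map-mono-≤ : {xs : List A} → (∀ {x} → x ∈ xs → f x ≤ g x) → sum (map f xs) ≤ sum (map g xs)
  sum-map-mono-≤ {[]}     _   = z≤n
  sum-map-mono-≤ {x ∷ xs} f≤g = +-mono-≤ (f≤g (here refl)) (sum-map-mono-≤ (f≤g ∘ there))

  -- The member `z` rules out the empty list, where both sums are 0.
  sum-map-mono-< : {xs : List A} {z : A} → z ∈ xs → (∀ {x} → x ∈ xs → f x < g x) →
    sum (map f xs) < sum (map g xs)
  sum-map-mono-< {x ∷ xs} _ f<g = +-mono-<-≤ (f<g (here refl)) (sum-map-mono-≤ (<⇒≤ ∘ f<g ∘ there))

-- The out-degrees and the in-degrees of a relation on a finite set have the same sum.
outdegree≮indegree : ∀ {a r} {A : Set a} {R : A → A → Set r} (R? : ∀ x y → Dec (R x y))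
  {xs : List A} {z : A} → z ∈ xs →
  ¬ (∀ {x} → x ∈ xs → length (filter (R? x) xs) < length (filter (λ y → R? y x) xs))
outdegree≮indegree R? {xs} z∈xs out<in =
  <-irrefl (sum-length-filter-comm R? xs xs) (sum-map-mono-< z∈xs out<in)

Unique-resp-↭ : ∀ {a} {A : Set a} {xs ys : List A} → xs ↭ ys → Unique xs → Unique ys
Unique-resp-↭ = Permutation.Unique-resp-↭ (setoid _) ∘ ↭⇒↭ₛ

-- Follow the walk up to the first step that leaves `P`. Connectedness enters the proof through this
-- lemma.
boundary-edge : ∀ {a p r} {A : Set a} {R : A → A → Set r} {P : A → Set p} → Decidable P →
  ∀ {u v} → Star R u v → P u → ¬ P v → ∃₂ λ x y → P x × ¬ P y × R x y
boundary-edge P? ε Pu ¬Pv = contradiction Pu ¬Pv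
boundary-edge P? (_◅_ {j = w} Ruw w⟶v) Pu ¬Pv with P? w
... | yes Pw = boundary-edge P? w⟶v Pw ¬Pv
... | no ¬Pw = _ , w , Pu , ¬Pw , Ruw

module _ (G : Graph n) where
  open Graph G renaming (sym to ~-sym)
  open Cycle

  private
    variable
      a b c d p q u v w x y : Fin n
      l m : List (Fin n)

  -- Neighbourhoods and walks.

  ∈N⁺ : u ~ v → v ∈ₛ N G u
  ∈N⁺ {u} {v} u~v = lookup⇒[]= v (N G u) (trans (lookup∘tabulate _ v) (dec-true (u ~? v) u~v))

  ∈N⁻ : v ∈ₛ N G u → u ~ v
  ∈N⁻ {v} {u} v∈Nu with u ~? v | trans (sym (lookup∘tabulate (λ v → does (u ~? v)) v)) ([]=⇒lookup v∈Nu)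
  ... | yes u~v | _ = u~v

  ∈N[]⁻ : v ∈ₛ N[_] G u → u ~ v ⊎ v ≡ u
  ∈N[]⁻ {u = u} v∈N[u] with x∈p∪q⁻ (N G u) ⁅ u ⁆ v∈N[u]
  ... | inj₁ v∈Nu = inj₁ (∈N⁻ v∈Nu)
  ... | inj₂ v∈⁅u⁆ = inj₂ (x∈⁅y⁆⇒x≡y u v∈⁅u⁆)

  -- The list contains all vertices of the walk, both endpoints included.
  data Walk : Fin n → List (Fin n) → Fin n → Set where
    [_] : ∀ a → Walk a (a ∷ []) a
    _∷_ : a ~ b → Walk b l c → Walk a (a ∷ l) c

  -- Each pair is a vertex with its successor. For a closed walk, `(b , a) ∷ steps w` adds the
  -- closing edge and so lists all pairs (v , v⁺) of the cycle.
  steps : Walk a l b → List (Fin n × Fin n)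
  steps [ a ]                   = []
  steps (_∷_ {a = a} {b} a~b w) = (a , b) ∷ steps w

  join : Walk a l b → b ~ c → Walk c m d → Walk a (l ++ m) d
  join [ a ]     b~c v = b~c ∷ v
  join (a~b ∷ w) b~c v = a~b ∷ join w b~c v

  steps-join : (w : Walk a l b) (b~c : b ~ c) (v : Walk c m d) →
    steps (join w b~c v) ≡ steps w ++ (b , c) ∷ steps v
  steps-join [ a ]     b~c v = refl
  steps-join (a~b ∷ w) b~c v = cong (_ ∷_) (steps-join w b~c v)

  reverseWalk : Walk a l b → ∃[ m ] Walk b m a × m ↭ l
  reverseWalk [ a ] = _ , [ a ] , ↭-refl
  reverseWalk (_∷_ {a = a} a~b w) with m , w⁻¹ , m↭l ← reverseWalk w =
    m ∷ʳ a , join w⁻¹ (~-sym a~b) [ a ] , ↭-trans (↭-sym (∷↭∷ʳ a m)) (prep a m↭l)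

  -- The right-hand side is the list of second components of `(b , a) ∷ steps w`. Being an equality
  -- of lists, it carries uniqueness of the vertices over to the successors.
  vertices-heads : (w : Walk a l b) → l ≡ a ∷ map proj₂ (steps w)
  vertices-heads [ a ]     = refl
  vertices-heads (a~b ∷ w) = cong (_ ∷_) (vertices-heads w)

  -- The first components form `l` rotated by one place, with `b` in front, so membership is stated
  -- instead of equality.
  vertices-tails : (w : Walk a l b) → v ∈ l → v ∈ map proj₁ ((b , a) ∷ steps w)
  vertices-tails [ a ]     v∈l         = v∈l
  vertices-tails (a~b ∷ w) (here refl) = there (here refl)
  vertices-tails (a~b ∷ w) (there v∈l) with vertices-tails w v∈l
  ... | here  v≡c = here v≡c
  ... | there v∈w = there (there v∈w)

  cut : (w : Walk a l b) → (p , q) ∈ steps w →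
    p ~ q × ∃₂ λ l₁ l₂ → Σ (Walk a l₁ p) λ w₁ → Σ (Walk q l₂ b) λ w₂ →
      l ≡ l₁ ++ l₂ × steps w ≡ steps w₁ ++ (p , q) ∷ steps w₂
  cut (a~b ∷ w) (here refl) = a~b , _ , _ , [ _ ] , w , refl , refl
  cut (a~b ∷ w) (there s∈w) with p~q , _ , _ , w₁ , w₂ , refl , eq ← cut w s∈w =
    p~q , _ , _ , a~b ∷ w₁ , w₂ , refl , cong (_ ∷_) eq

  -- Reading the closed walk from `q` onwards turns the chosen pair into the closing one, so that
  -- the cycle can be opened at any edge.
  rotate : (w : Walk a l b) → b ~ a → (p , q) ∈ (b , a) ∷ steps w →
    p ~ q × ∃ λ m → Σ (Walk q m p) λ v → m ↭ l × (b , a) ∷ steps w ↭ (p , q) ∷ steps v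
  rotate w b~a (here refl) = b~a , _ , w , ↭-refl , ↭-refl
  rotate {a} {b = b} {p} {q} w b~a (there s∈w)
    with p~q , l₁ , l₂ , w₁ , w₂ , refl , eq ← cut w s∈w
    = p~q , _ , join w₂ b~a w₁ , ++-comm l₂ l₁ , (begin
      (b , a) ∷ steps w                             ≡⟨ cong (_ ∷_) eq ⟩
      (b , a) ∷ steps w₁ ++ (p , q) ∷ steps w₂      ↭⟨ ++-comm ((b , a) ∷ steps w₁) ((p , q) ∷ steps w₂) ⟩
      (p , q) ∷ steps w₂ ++ (b , a) ∷ steps w₁      ≡⟨ cong (_ ∷_) (steps-join w₂ b~a w₁) ⟨
      (p , q) ∷ steps (join w₂ b~a w₁)              ∎)
    where open PermutationReasoning

  linked⇒walk : Linked _~_ (a ∷ l ∷ʳ c) → ∃[ b ] Walk a (a ∷ l) b × b ~ c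
  linked⇒walk {a} {[]}    (a~c ∷ [-]) = a , [ a ] , a~c
  linked⇒walk {a} {_ ∷ l} (a~b ∷ r) with b , w , b~c ← linked⇒walk r = b , a~b ∷ w , b~c

  walk⇒linked : Walk a l b → b ~ c → Linked _~_ (l ∷ʳ c)
  walk⇒linked [ a ]             b~c = b~c ∷ [-]
  walk⇒linked (a~b ∷ [ b ])     b~c = a~b ∷ walk⇒linked [ b ] b~c
  walk⇒linked (a~b ∷ w@(_ ∷ _)) b~c = a~b ∷ walk⇒linked w b~c

  closedWalk⇒cycle : Walk a l b → b ~ a → Unique l → 3 ≤ length l → ∃[ C ] vertices {G = G} C ≡ l
  -- Both clauses agree; the match only exposes `l` as a list with head `a`.
  closedWalk⇒cycle w@([ a ])   b~a l! 3≤l =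
    record { start = _ ; rest = _ ; unique = l! ; closed = walk⇒linked w b~a ; long = 3≤l } , refl
  closedWalk⇒cycle w@(a~c ∷ v) b~a l! 3≤l =
    record { start = _ ; rest = _ ; unique = l! ; closed = walk⇒linked w b~a ; long = 3≤l } , refl

  -- Two ways to lengthen a cycle.

  module _ (C : Cycle G) where

    -- The permutation alone yields uniqueness, the length and the inclusion of vertices, so the
    -- order in which the new cycle visits them is irrelevant.
    extend : Walk a l b → b ~ a → y ∉ vertices C → l ↭ y ∷ vertices C → Extendable G C
    extend w b~a y∉C l↭yC
      with C′ , refl ← closedWalk⇒cycle w b~a
             (Unique-resp-↭ (↭-sym l↭yC) (All.tabulate (λ { v∈C refl → y∉C v∈C }) ∷ unique C))
             (≤-trans (m≤n⇒m≤1+n (long C)) (≤-reflexive (sym (↭-length l↭yC))))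
      = C′ , ↭-length l↭yC , ∈-resp-↭ (↭-sym l↭yC) ∘ there

    module _ (w : Walk a (vertices C) b) (b~a : b ~ a) where

      -- Opened at the edge from `p` to `q`, the cycle becomes a path from `q` to `p`, which `y`
      -- closes again.
      insertion : (p , q) ∈ (b , a) ∷ steps w → y ∉ vertices C → y ~ p → y ~ q → Extendable G C
      insertion {y = y} s∈C y∉C y~p y~q with _ , _ , v , m↭C , _ ← rotate w b~a s∈C =
        extend (y~q ∷ v) (~-sym y~p) y∉C (prep y m↭C)

      -- With s = (p , p⁺), t = (q , q⁺) and C = p⁺ ⋯ q q⁺ ⋯ p, the longer cycle is
      -- x q ⋯ p⁺ q⁺ ⋯ p, whose first arc is traversed backwards.
      crossing : {s t : Fin n × Fin n} → s ∈ (b , a) ∷ steps w → t ∈ (b , a) ∷ steps w →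
        x ∉ vertices C → x ~ proj₁ s → x ~ proj₁ t → proj₂ s ~ proj₂ t → Extendable G C
      crossing {x = x} s∈C t∈C x∉C x~s x~t s⁺~t⁺
        with _ , m , v , m↭C , C↭sv ← rotate w b~a s∈C
        with ∈-resp-↭ C↭sv t∈C
      ... | here refl = contradiction s⁺~t⁺ (irrefl refl)
      ... | there t∈v
        with _ , _ , l₂ , v₁ , v₂ , refl , _ ← cut v t∈v
        with _ , v₁⁻¹ , r↭l₁ ← reverseWalk v₁
        = extend (x~t ∷ join v₁⁻¹ s⁺~t⁺ v₂) (~-sym x~s) x∉C (prep x (↭-trans (++⁺ʳ l₂ r↭l₁) m↭C))

  -- Consequences of the neighbourhood condition.

  module _ (dense : ∀ (u v w : Fin n) → InducedPath₃ G v u w →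
              ∣ N G u ∩ N G v ∩ N G w ∣ > ∣ N G u ─ (N[_] G v ∪ N[_] G w) ∣) where

    -- The strict inequality makes the triple intersection nonempty.
    common-neighbour : InducedPath₃ G v u w → ∃[ z ] u ~ z × v ~ z × w ~ z
    common-neighbour {v} {u} {w} P with any? (λ z → (u ~? z) ×-dec (v ~? z) ×-dec (w ~? z))
    ... | yes common = common
    ... | no  ∄      = contradiction (≤-trans (s≤s z≤n) (dense u v w P)) (<⇒≱ (s≤s (∣-∣≤length [] none)))
      where
      none : x ∈ₛ N G u ∩ N G v ∩ N G w → x ∈ []
      none x∈∩ with x∈u , x∈vw ← x∈p∩q⁻ (N G u) _ x∈∩
               with x∈v , x∈w ← x∈p∩q⁻ (N G v) _ x∈vw
               = ⊥-elim (∄ (_ , ∈N⁻ x∈u , ∈N⁻ x∈v , ∈N⁻ x∈w))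

    -- Take a neighbour `v` of `u` and a third vertex `w` adjacent to one of them. The three form a
    -- triangle or an induced path; in the latter case a common neighbour `t` of the path completes
    -- a triangle on the edge `u v`.
    onTriangle : 3 ≤ n → Connected G → ∀ u → OnTriangle G u
    onTriangle 3≤n connected u
      with y , y∉u ← ∃-unlisted (u ∷ []) (<⇒≤ 3≤n)
      with _ , v , here refl , v∉u , u~v ←
        boundary-edge (_∈? (u ∷ [])) (connected u y) (here refl) y∉u
      with z , z∉uv ← ∃-unlisted (u ∷ v ∷ []) 3≤n
      with boundary-edge (_∈? (u ∷ v ∷ [])) (connected u z) (here refl) z∉uv
    ... | _ , w , here refl , w∉uv , u~w with v ~? w
    ...   | yes v~w = v , w , u~v , v~w , ~-sym u~w
    ...   | no  v≁w with t , u~t , v~t , _ ← common-neighbour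
                           ((λ v≡w → w∉uv (there (here (sym v≡w)))) , u~v , u~w , v≁w)
      = v , t , u~v , v~t , ~-sym u~t
    onTriangle 3≤n connected u | _ , w , there (here refl) , w∉uv , v~w with u ~? w
    ...   | yes u~w = v , w , u~v , v~w , ~-sym u~w
    ...   | no  u≁w with t , v~t , u~t , _ ← common-neighbour
                           ((λ u≡w → w∉uv (here (sym u≡w))) , ~-sym u~v , v~w , u≁w)
      = v , t , u~v , v~t , ~-sym u~t

    -- Extending a cycle that has an outside neighbour.

    extendable : (C : Cycle G) → u ∈ vertices C → x ∉ vertices C → u ~ x → Extendable G C
    extendable {u} {x} C u∈C x∉C u~x with b , w , b~a ← linked⇒walk (closed C) = result
      where
      S : List (Fin n × Fin n)
      S = (b , start C) ∷ steps w

      x~tail? : Decidable (λ s → x ~ proj₁ s)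
      x~tail? s = x ~? proj₁ s

      -- Each neighbour of `x` on `C` is stored together with its successor.
      W : List (Fin n × Fin n)
      W = filter x~tail? S

      vertices≡ : vertices C ≡ map proj₂ S
      vertices≡ = vertices-heads w

      W⊆S : ∀ {s} → s ∈ W → s ∈ S × x ~ proj₁ s
      W⊆S = ∈-filter⁻ x~tail? {xs = S}

      neighbour⇒∈W : x ~ v → v ∈ vertices C → ∃[ t ] t ∈ W × v ≡ proj₁ t
      neighbour⇒∈W x~v v∈C with t , t∈S , refl ← ∈-map⁻ proj₁ (vertices-tails w v∈C) =
        t , ∈-filter⁺ x~tail? t∈S x~v , refl

      nonempty : ∃ (_∈ W)
      nonempty with t , t∈W , _ ← neighbour⇒∈W (~-sym u~x) u∈C = t , t∈W

      head∈C : ∀ {s} → s ∈ S → proj₂ s ∈ vertices C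
      head∈C {s} s∈S = subst (proj₂ s ∈_) (sym vertices≡) (∈-map⁺ proj₂ s∈S)

      module NotExtended
        (¬inserted : ¬ Any.Any (λ s → ∃[ y ] y ∉ vertices C × y ~ proj₁ s × y ~ proj₂ s) S)
        (¬crossed  : ¬ Any.Any (λ s → Any.Any (λ t → proj₂ s ~ proj₂ t) W) W) where

        -- Since `p ~ q`, the left count may include `q`, which is outside `B`, and the right count
        -- includes `p`, which is outside `A`. The strictness of `dense` absorbs the first extra
        -- vertex, and the second makes the result strict.
        out<in : ∀ {s} → s ∈ W → length (filter (λ t → proj₁ s ~? proj₂ t) W) <
                                 length (filter (λ t → proj₁ t ~? proj₂ s) W)
        out<in {s@(p , q)} s∈W = begin-strict
          length (filter (λ t → p ~? proj₂ t) W)                  ≡⟨ length-map proj₂ (filter _ W) ⟨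
          length (map proj₂ (filter (λ t → p ~? proj₂ t) W))      ≤⟨ length≤∣-∣ heads-unique heads⊆ ⟩
          ∣ B ∪ ⁅ q ⁆ ∣                                           ≤⟨ ∣p∪⁅x⁆∣≤1+∣p∣ B q ⟩
          suc ∣ B ∣                                               ≤⟨ dense p x q (x≢q , p~x , p~q , x≁q) ⟩
          ∣ A ∣                                                   <⟨ x∉p⇒∣p∣<∣p∪⁅x⁆∣ p∉A ⟩
          ∣ A ∪ ⁅ p ⁆ ∣                                           ≤⟨ ∣-∣≤length _ ⊆tails ⟩
          length (map proj₁ (filter (λ t → proj₁ t ~? q) W))      ≡⟨ length-map proj₁ (filter _ W) ⟩
          length (filter (λ t → proj₁ t ~? q) W)                  ∎
          where
          open ≤-Reasoning
          A = N G p ∩ N G x ∩ N G q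
          B = N G p ─ (N[_] G x ∪ N[_] G q)

          s∈S : s ∈ S
          s∈S = proj₁ (W⊆S s∈W)

          x≢q : x ≢ q
          x≢q refl = x∉C (head∈C s∈S)

          p~x : p ~ x
          p~x = ~-sym (proj₂ (W⊆S s∈W))

          p~q : p ~ q
          p~q = proj₁ (rotate w b~a s∈S)

          x≁q : ¬ x ~ q
          -- Otherwise `x` itself could be inserted between `p` and `q`.
          x≁q x~q = ¬inserted (lose s∈S (x , x∉C , ~-sym p~x , x~q))

          p∉A : p ∉ₛ A
          p∉A p∈A = irrefl refl (∈N⁻ (proj₁ (x∈p∩q⁻ (N G p) _ p∈A)))

          heads-unique : Unique (map proj₂ (filter (λ t → p ~? proj₂ t) W))
          heads-unique = AllPairs.map⁺ (AllPairs.filter⁺ (λ t → p ~? proj₂ t)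
            (AllPairs.filter⁺ x~tail? (AllPairs.map⁻ (subst Unique vertices≡ (unique C)))))

          -- A successor t⁺ other than `q` is not adjacent to `q`, as there is no crossing, nor to
          -- `x`, as `x` cannot be inserted after t; and it differs from `x` because it lies on `C`.
          heads⊆ : v ∈ map proj₂ (filter (λ t → p ~? proj₂ t) W) → v ∈ₛ B ∪ ⁅ q ⁆
          heads⊆ v∈
            with t , t∈ , refl ← ∈-map⁻ proj₂ v∈
            with t∈W , p~t⁺ ← ∈-filter⁻ (λ t → p ~? proj₂ t) {xs = W} t∈
            with proj₂ t ≟ q
          ... | yes refl = x∈p∪q⁺ (inj₂ (x∈⁅x⁆ q))
          ... | no  t⁺≢q = x∈p∪q⁺ (inj₁ (x∈p∧x∉q⇒x∈p─q (∈N⁺ p~t⁺) nonadjacent))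
            where
            nonadjacent : proj₂ t ∉ₛ N[_] G x ∪ N[_] G q
            nonadjacent t⁺∈ with x∈p∪q⁻ (N[_] G x) _ t⁺∈
            ... | inj₂ t⁺∈N[q] with ∈N[]⁻ t⁺∈N[q]
            ...   | inj₁ q~t⁺ = ¬crossed (lose s∈W (lose t∈W q~t⁺))
            ...   | inj₂ t⁺≡q = t⁺≢q t⁺≡q
            nonadjacent t⁺∈ | inj₁ t⁺∈N[x] with t∈S , x~t ← W⊆S t∈W with ∈N[]⁻ t⁺∈N[x]
            ...   | inj₁ x~t⁺ = ¬inserted (lose t∈S (x , x∉C , x~t , x~t⁺))
            ...   | inj₂ refl = x∉C (head∈C t∈S)

          tail∈ : x ~ v → v ~ q → v ∈ vertices C → v ∈ map proj₁ (filter (λ t → proj₁ t ~? q) W)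
          tail∈ x~v v~q v∈C with t , t∈W , refl ← neighbour⇒∈W x~v v∈C =
            ∈-map⁺ proj₁ (∈-filter⁺ (λ t → proj₁ t ~? q) t∈W v~q)

          ⊆tails : v ∈ₛ A ∪ ⁅ p ⁆ → v ∈ map proj₁ (filter (λ t → proj₁ t ~? q) W)
          ⊆tails {v} v∈ with x∈p∪q⁻ A ⁅ p ⁆ v∈
          ... | inj₂ v∈⁅p⁆ with refl ← x∈⁅y⁆⇒x≡y p v∈⁅p⁆ =
            ∈-map⁺ proj₁ (∈-filter⁺ (λ t → proj₁ t ~? q) s∈W p~q)
          ... | inj₁ v∈A
            with v∈p , v∈xq ← x∈p∩q⁻ (N G p) _ v∈A
            with v∈x , v∈q ← x∈p∩q⁻ (N G x) _ v∈xq
            -- Off `C`, the vertex `v` could be inserted between `p` and `q`. On `C`, being adjacent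
            -- to `x`, it is the first component of a pair in `W`.
            = tail∈ (∈N⁻ v∈x) (~-sym (∈N⁻ v∈q)) (decidable-stable (v ∈? vertices C) λ v∉C →
                ¬inserted (lose s∈S (v , v∉C , ~-sym (∈N⁻ v∈p) , ~-sym (∈N⁻ v∈q))))

      result : Extendable G C
      result with Any.any? (λ s → any? λ y →
                    (y ∉? vertices C) ×-dec (y ~? proj₁ s) ×-dec (y ~? proj₂ s)) S
      ... | yes inserted with _ , s∈S , y , y∉C , y~p , y~q ← find inserted =
        insertion C w b~a s∈S y∉C y~p y~q
      ... | no  ¬inserted with Any.any? (λ s → Any.any? (λ t → proj₂ s ~? proj₂ t) W) W
      ...   | no ¬crossed = ⊥-elim (outdegree≮indegree (λ s t → proj₁ s ~? proj₂ t) (proj₂ nonempty)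
        (NotExtended.out<in ¬inserted ¬crossed))
      ...   | yes crossed
        with s , s∈W , crossed′ ← find crossed
        with t , t∈W , s⁺~t⁺ ← find crossed′
        with s∈S , x~s ← W⊆S s∈W
        with t∈S , x~t ← W⊆S t∈W
        = crossing C w b~a s∈S t∈S x∉C x~s x~t s⁺~t⁺

theorem9 : ∀ {n : ℕ} (G : Graph n) → 3 ≤ n → Connected G →
    (∀ (u v w : Fin n) → InducedPath₃ G v u w →
    ∣ N G u ∩ N G v ∩ N G w ∣ > ∣ N G u ─ (N[_] G v ∪ N[_] G w) ∣) →
    FullyCycleExtendable G
theorem9 G 3≤n connected dense = onTriangle G dense 3≤n connected , λ C ∣C∣<n →
  -- The cycle misses some `y`; a walk from the cycle to `y` leaves it along an edge from `u` to
  -- `x`.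
  let y , y∉C                 = ∃-unlisted (Cycle.vertices C) ∣C∣<n
      u , x , u∈C , x∉C , u~x = boundary-edge (λ v → v ∈? Cycle.vertices C)
                                  (connected (Cycle.start C) y) (here refl) y∉C
  in extendable G dense C u∈C x∉C u~x
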